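{- Player 1 has no admissible strategy in the game $\mathcal{G}$ and no admissible strategy in the game $\mathcal{A}$, where $\mathcal{A}$ and $\mathcal{G}$ are the following two games. Game $\mathcal{A}$: the vertices are $s_1,a,s_3$, all owned by Player 1; the edges are $(s_1,s_3),(s_1,a),(a,s_1),(s_3,s_3)$; the initial vertex is $s_1$. Game $\mathcal{G}$: the vertices are $s_1,s_2,a,s_3$, where $s_1,a,s_3$ are owned by Player 1 and $s_2$ is owned by the other player; the edges are $(s_1,s_3),(s_1,s_2),(s_2,a),(s_2,s_1),(a,s_1),(s_3,s_3)$; the initial vertex is $s_1$. In both games, the payoff of Player 1 for an outcome (starting at $s_1$) is $0$ if the outcome does not visit $s_3$, and otherwise is the number of times the vertex $a$ appears in the outcome.
   Context: An outcome is an infinite path in the game graph; a history is a non-empty finite prefix of an outcome. A strategy of a player maps every history ending in a vertex owned by that player to a successor of that last vertex. A strategy $\sigma_1$ of Player 1 together with strategies $\sigma_{ -1}$ of all other players determines a unique outcome $\mathbf{Out}(\sigma_1,\sigma_{ -1})$ from the initial vertex. A strategy $\sigma$ of Player 1 very weakly dominates a strategy $\sigma'$ of Player 1 if $\mathrm{payoff}_1(\mathbf{Out}(\sigma',\sigma_{ -1}))\le\mathrm{payoff}_1(\mathbf{Out}(\sigma,\sigma_{ -1}))$ for all tuples $\sigma_{ -1}$ of strategies of the other players. It weakly dominates $\sigma'$ if it very weakly dominates $\sigma'$ and $\sigma'$ does not very weakly dominate $\sigma$. A strategy of Player 1 is admissible if no strategy of Player 1 weakly dominates it. (In $\mathcal{A}$,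 only Player 1 makes choices, so a strategy of Player 1 determines the outcome.) -}

module Defs where

open import Data.Empty using (⊥-elim)
open import Data.Fin using (Fin; zero; suc)
open import Data.Fin.Permutation using (↔⇒≡)
open import Data.Nat using (ℕ; zero; suc; _≤_; _<_; s≤s; _≤′_; ≤′-refl; ≤′-step)
open import Data.Nat.Properties using (≮⇒≥; ≤⇒≤′; _<?_)
open import Data.Product using (∃; _×_; _,_; proj₁; proj₂)
open import Data.Sum using (_⊎_; inj₁; inj₂)
open import Function.Bundles using (_↔_; Inverse; mk↔ₛ′)
open import Function.Construct.Composition using (_↔-∘_)
open import Function.Construct.Symmetry using (↔-sym)
open import Relation.Binary using (DecidableEquality)
open import Relation.Binary.PropositionalEquality
  using (_≡_; _≢_; refl; sym; trans; cong; subst)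
open import Relation.Nullary using (¬_; Dec; yes; no)
open import Relation.Nullary.Decidable.Core using (¬¬-excluded-middle)
import Axiom.UniquenessOfIdentityProofs as UIP

-- Player 1 is `zero`; the other players are `suc i` for `i : Fin others`.
record Arena : Set₁ where
  infix 4 _⟶_
  field
    Vertex      : Set
    _⟶_         : Vertex → Vertex → Set
    nonblocking : ∀ v → ∃ λ w → v ⟶ w
    others      : ℕ
    owner       : Vertex → Fin (suc others)
    init        : Vertex

  record Outcome : Set where
    field
      at   : ℕ → Vertex
      step : ∀ i → at i ⟶ at (suc i)

  open Outcome public

  -- Non-empty finite paths, indexed by their last vertex.  As no vertex is
  -- blocking, these are exactly the non-empty finite prefixes of outcomes.
  infixl 5 _▷_
  data History : Vertex → Set where
    [_] : ∀ v → History v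
    _▷_ : ∀ {v w} → History v → v ⟶ w → History w

  Successor : Vertex → Set
  Successor v = ∃ λ w → v ⟶ w

  Strategy : Fin (suc others) → Set
  Strategy p = (v : Vertex) → History v → owner v ≡ p → Successor v

  Strategy₁ : Set
  Strategy₁ = Strategy zero

  Strategy₋₁ : Set
  Strategy₋₁ = (i : Fin others) → Strategy (suc i)

  module _ (σ₁ : Strategy₁) (σ₋₁ : Strategy₋₁) where

    move : (v : Vertex) → History v → (p : Fin (suc others)) → owner v ≡ p → Successor v
    move v h zero    own = σ₁ v h own
    move v h (suc i) own = σ₋₁ i v h own

    next : (v : Vertex) → History v → Successor v
    next v h = move v h (owner v) refl

    play : ℕ → ∃ History
    play zero    = init , [ init ]
    play (suc n) = let (v , h) = play n
                       (w , e) = next v h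
                   in w , h ▷ e

    Out : Outcome
    Out .at   n = proj₁ (play n)
    Out .step n = proj₂ (next (proj₁ (play n)) (proj₂ (play n)))

-- The payoff of Player 1 is given by its graph, since it need not be computable
-- from the outcome.  `payoff-total` is existence in its constructive form: with
-- excluded middle, `Payoff₁` is the graph of a function from outcomes to ℕ.
record Game : Set₁ where
  field
    arena : Arena
  open Arena arena public
  field
    Payoff₁       : Outcome → ℕ → Set
    payoff-unique : ∀ ρ {m n} → Payoff₁ ρ m → Payoff₁ ρ n → m ≡ n
    payoff-total  : ∀ ρ → ¬ ¬ ∃ (Payoff₁ ρ)

  -- payoff₁ ρ ≤ payoff₁ ρ′
  infix 4 _≤ₚ_
  _≤ₚ_ : Outcome → Outcome → Set
  ρ ≤ₚ ρ′ = ∀ m n → Payoff₁ ρ m → Payoff₁ ρ′ n → m ≤ n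

  VeryWeaklyDominates : Strategy₁ → Strategy₁ → Set
  VeryWeaklyDominates σ σ′ = (σ₋₁ : Strategy₋₁) → Out σ′ σ₋₁ ≤ₚ Out σ σ₋₁

  WeaklyDominates : Strategy₁ → Strategy₁ → Set
  WeaklyDominates σ σ′ = VeryWeaklyDominates σ σ′ × ¬ VeryWeaklyDominates σ′ σ

  Admissible : Strategy₁ → Set
  Admissible σ = ¬ ∃ λ σ′ → WeaklyDominates σ′ σ

bounded⇒finite : ∀ N (P : ℕ → Set) → (∀ i → Dec (P i)) → (∀ i (p q : P i) → p ≡ q) →
                 (∀ i → P i → i < N) → ∃ λ n → Fin n ↔ ∃ P
bounded⇒finite zero P P? irr bd = 0 , mk↔ₛ′ (λ ()) (λ (i , p) → ⊥-elim (absurd i p)) (λ (i , p) → ⊥-elim (absurd i p)) (λ ())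
  where
  absurd : ∀ i → ¬ P i
  absurd i p with bd i p
  ... | ()
bounded⇒finite (suc N) P P? irr bd
  with bounded⇒finite N (λ i → P (suc i)) (λ i → P? (suc i)) (λ i → irr (suc i))
         (λ i p → pred< (bd (suc i) p))
  where
  pred< : ∀ {i} → suc i < suc N → i < N
  pred< (s≤s q) = q
... | n , e with P? 0
... | yes p₀ = suc n , mk↔ₛ′ to from to-from from-to
  where
  open Inverse e using (strictlyInverseˡ; strictlyInverseʳ) renaming (to to f; from to g)
  to : Fin (suc n) → ∃ P
  to zero    = 0 , p₀
  to (suc k) = let (i , p) = f k in suc i , p
  from : ∃ P → Fin (suc n)
  from (zero  , _) = zero
  from (suc i , p) = suc (g (i , p))
  to-from : ∀ x → to (from x) ≡ x
  to-from (zero  , p) = cong (0 ,_) (irr 0 p₀ p)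
  to-from (suc i , p) = cong (λ (i , p) → suc i , p) (strictlyInverseˡ (i , p))
  from-to : ∀ k → from (to k) ≡ k
  from-to zero    = refl
  from-to (suc k) = cong suc (strictlyInverseʳ k)
... | no ¬p₀ = n , mk↔ₛ′ to from to-from strictlyInverseʳ
  where
  open Inverse e using (strictlyInverseˡ; strictlyInverseʳ) renaming (to to f; from to g)
  to : Fin n → ∃ P
  to k = let (i , p) = f k in suc i , p
  from : ∃ P → Fin n
  from (zero  , p) = ⊥-elim (¬p₀ p)
  from (suc i , p) = g (i , p)
  to-from : ∀ x → to (from x) ≡ x
  to-from (zero  , p) = ⊥-elim (¬p₀ p)
  to-from (suc i , p) = cong (λ (i , p) → suc i , p) (strictlyInverseˡ (i , p))

-- The payoff function that is 0 on outcomes not visiting `target`, and counts the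
-- occurrences of `counted` on the others.
module CountIfReached
  (arena : Arena) (_≟_ : DecidableEquality (Arena.Vertex arena))
  (target counted : Arena.Vertex arena)
  (target≢counted : target ≢ counted)
  (absorbing : ∀ {w} → Arena._⟶_ arena target w → w ≡ target)
  where

  open Arena arena

  Occurrence : Vertex → Outcome → Set
  Occurrence v ρ = ∃ λ i → ρ .at i ≡ v

  Payoff : Outcome → ℕ → Set
  Payoff ρ n = (¬ Occurrence target ρ × n ≡ 0)
             ⊎ (Occurrence target ρ × Fin n ↔ Occurrence counted ρ)

  unique : ∀ ρ {m n} → Payoff ρ m → Payoff ρ n → m ≡ n
  unique ρ (inj₁ (_ , p))  (inj₁ (_ , q))  = trans p (sym q)
  unique ρ (inj₁ (¬t , _)) (inj₂ (t , _))  = ⊥-elim (¬t t)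
  unique ρ (inj₂ (t , _))  (inj₁ (¬t , _)) = ⊥-elim (¬t t)
  unique ρ (inj₂ (_ , e))  (inj₂ (_ , f))  = ↔⇒≡ (↔-sym f ↔-∘ e)

  stays : ∀ ρ {N i} → ρ .at N ≡ target → N ≤′ i → ρ .at i ≡ target
  stays ρ t ≤′-refl     = t
  stays ρ t (≤′-step {i} l) =
    absorbing (subst (_⟶ ρ .at (suc i)) (stays ρ t l) (ρ .step i))

  finite : ∀ ρ → Occurrence target ρ → ∃ λ n → Fin n ↔ Occurrence counted ρ
  finite ρ (N , t) = bounded⇒finite N (λ i → ρ .at i ≡ counted) (λ i → ρ .at i ≟ counted)
    (λ i → UIP.Decidable⇒UIP.≡-irrelevant _≟_) before
    where
    before : ∀ i → ρ .at i ≡ counted → i < N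
    before i c with i <? N
    ... | yes l = l
    ... | no ¬l = ⊥-elim (target≢counted (trans (sym (stays ρ t (≤⇒≤′ (≮⇒≥ ¬l)))) c))

  total : ∀ ρ → ¬ ¬ ∃ (Payoff ρ)
  total ρ k = ¬¬-excluded-middle λ where
    (yes t) → let (n , e) = finite ρ t in k (n , inj₂ (t , e))
    (no ¬t) → k (0 , inj₁ (¬t , refl))

  game : Game
  game = record
    { arena = arena ; Payoff₁ = Payoff ; payoff-unique = unique ; payoff-total = total }

module A where

  data Vertex : Set where
    s₁ a s₃ : Vertex

  data Edge : Vertex → Vertex → Set where
    s₁s₃ : Edge s₁ s₃
    s₁a  : Edge s₁ a
    as₁  : Edge a s₁
    s₃s₃ : Edge s₃ s₃

  _≟_ : DecidableEquality Vertex
  s₁ ≟ s₁ = yes refl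
  s₁ ≟ a  = no λ ()
  s₁ ≟ s₃ = no λ ()
  a  ≟ s₁ = no λ ()
  a  ≟ a  = yes refl
  a  ≟ s₃ = no λ ()
  s₃ ≟ s₁ = no λ ()
  s₃ ≟ a  = no λ ()
  s₃ ≟ s₃ = yes refl

  arena : Arena
  arena = record
    { Vertex      = Vertex
    ; _⟶_         = Edge
    ; nonblocking = λ where
        s₁ → s₃ , s₁s₃
        a  → s₁ , as₁
        s₃ → s₃ , s₃s₃
    ; others      = 0
    ; owner       = λ _ → zero
    ; init        = s₁
    }

  𝒜 : Game
  𝒜 = CountIfReached.game arena _≟_ s₃ a (λ ()) λ { s₃s₃ → refl }

module G where

  data Vertex : Set where
    s₁ s₂ a s₃ : Vertex

  data Edge : Vertex → Vertex → Set where
    s₁s₃ : Edge s₁ s₃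
    s₁s₂ : Edge s₁ s₂
    s₂a  : Edge s₂ a
    s₂s₁ : Edge s₂ s₁
    as₁  : Edge a s₁
    s₃s₃ : Edge s₃ s₃

  _≟_ : DecidableEquality Vertex
  s₁ ≟ s₁ = yes refl
  s₁ ≟ s₂ = no λ ()
  s₁ ≟ a  = no λ ()
  s₁ ≟ s₃ = no λ ()
  s₂ ≟ s₁ = no λ ()
  s₂ ≟ s₂ = yes refl
  s₂ ≟ a  = no λ ()
  s₂ ≟ s₃ = no λ ()
  a  ≟ s₁ = no λ ()
  a  ≟ s₂ = no λ ()
  a  ≟ a  = yes refl
  a  ≟ s₃ = no λ ()
  s₃ ≟ s₁ = no λ ()
  s₃ ≟ s₂ = no λ ()
  s₃ ≟ a  = no λ ()
  s₃ ≟ s₃ = yes refl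

  owner : Vertex → Fin 2
  owner s₁ = zero
  owner s₂ = suc zero
  owner a  = zero
  owner s₃ = zero

  arena : Arena
  arena = record
    { Vertex      = Vertex
    ; _⟶_         = Edge
    ; nonblocking = λ where
        s₁ → s₃ , s₁s₃
        s₂ → a , s₂a
        a  → s₁ , as₁
        s₃ → s₃ , s₃s₃
    ; others      = 1
    ; owner       = owner
    ; init        = s₁
    }

  𝒢 : Game
  𝒢 = CountIfReached.game arena _≟_ s₃ a (λ ()) λ { s₃s₃ → refl }

open A public using (𝒜)
open G public using (𝒢)

{-# OPTIONS --safe #-}
-- Against a strategy σ, consider the strategy that, at the moment when σ would
-- leave to s₃, makes one more round and leaves at the next visit to s₁.  It never
-- collects fewer visits to a than σ, and it collects one more when the other
-- player moves to a in the extra round (in 𝒜, always).  Hence it weakly dominates σ as soon as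
-- some outcome of σ visits s₃.  Otherwise every payoff of σ is 0, and σ is weakly
-- dominated by the strategy that makes one round and then leaves.
module Submission where

open import Defs
open import Data.Bool using (Bool; true; false; if_then_else_)
open import Data.Empty using (⊥-elim)
open import Data.Fin using (Fin; zero; suc)
open import Data.Fin.Properties using (injective⇒≤; nonZeroIndex)
open import Data.Nat using (ℕ; zero; suc; _+_; _≤_; _<_; z≤n; >-nonZero⁻¹)
open import Data.Nat.Properties using (<⇒≱)
open import Data.Product using (∃; _×_; _,_; proj₁; proj₂)
open import Data.Sum using (inj₁; inj₂)
open import Function.Bundles using (_↔_; _↣_; Inverse; Injection; mk↣)
open import Function.Construct.Composition using (_↣-∘_)
open import Function.Construct.Symmetry using (↔-sym)
open import Function.Definitions using (Injective)
open import Function.Properties.Inverse using (↔⇒↣)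
open import Relation.Binary using (DecidableEquality)
open import Relation.Binary.PropositionalEquality
  using (_≡_; _≢_; refl; sym; trans; cong; subst)
open import Relation.Nullary using (¬_; yes; no)
open import Relation.Nullary.Decidable.Core using (¬¬-excluded-middle)
import Axiom.UniquenessOfIdentityProofs as UIP

-- Comparing finite cardinalities by injections

↣⇒≤ : ∀ {m n} → Fin m ↣ Fin n → m ≤ n
↣⇒≤ f = injective⇒≤ (Injection.injective f)

↣-missing⇒< : ∀ {m n} (f : Fin m ↣ Fin n) j → (∀ k → Injection.to f k ≢ j) → m < n
↣-missing⇒< {m} {n} f j missing = injective⇒≤ {f = g} g-injective
  where
  g : Fin (suc m) → Fin n
  g zero    = j
  g (suc k) = Injection.to f k
  g-injective : Injective _≡_ _≡_ g
  g-injective {zero}  {zero}  _  = refl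
  g-injective {zero}  {suc l} eq = ⊥-elim (missing l (sym eq))
  g-injective {suc k} {zero}  eq = ⊥-elim (missing k eq)
  g-injective {suc k} {suc l} eq = cong suc (Injection.injective f eq)

-- Comparing payoffs and plays in an arena with an absorbing target

module Comparison
  (arena : Arena) (_≟_ : DecidableEquality (Arena.Vertex arena))
  (target counted : Arena.Vertex arena)
  (target≢counted : target ≢ counted)
  (absorbing : ∀ {w} → Arena._⟶_ arena target w → w ≡ target)
  where

  open Arena arena
  open CountIfReached arena _≟_ target counted target≢counted absorbing
    using (Occurrence; Payoff; total; game)
  open Game game using (_≤ₚ_)

  -- Positionwise inclusion rather than an inequality of counts: it yields an injection of
  -- occurrences, and one missed position makes the inequality strict.
  CountedWithin : Outcome → Outcome → Set
  CountedWithin ρ ρ′ = ∀ i → ρ .at i ≡ counted → ρ′ .at i ≡ counted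

  occurrence-↣ : ∀ {ρ ρ′} → CountedWithin ρ ρ′ → Occurrence counted ρ ↣ Occurrence counted ρ′
  occurrence-↣ {ρ} {ρ′} c = mk↣ {to = f} injective
    where
    f : Occurrence counted ρ → Occurrence counted ρ′
    f (i , p) = i , c i p
    injective : Injective _≡_ _≡_ f
    injective {i , p} {j , q} eq with refl ← cong proj₁ eq =
      cong (i ,_) (UIP.Decidable⇒UIP.≡-irrelevant _≟_ p q)

  count-↣ : ∀ {ρ ρ′ m n} → CountedWithin ρ ρ′ →
            Fin m ↔ Occurrence counted ρ → Fin n ↔ Occurrence counted ρ′ → Fin m ↣ Fin n
  count-↣ {ρ} {ρ′} c e e′ = ↔⇒↣ (↔-sym e′) ↣-∘ (occurrence-↣ {ρ} {ρ′} c ↣-∘ ↔⇒↣ e)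

  -- If `ρ` misses `target`, its payoff is 0, so only a `ρ` that reaches it has to be compared.
  ≤ₚ-intro : ∀ ρ ρ′ → (Occurrence target ρ → Occurrence target ρ′ × CountedWithin ρ ρ′) →
             ρ ≤ₚ ρ′
  ≤ₚ-intro ρ ρ′ f _ _ (inj₁ (_ , refl)) _               = z≤n
  ≤ₚ-intro ρ ρ′ f _ _ (inj₂ (t , _))    (inj₁ (¬t , _)) = ⊥-elim (¬t (proj₁ (f t)))
  ≤ₚ-intro ρ ρ′ f _ _ (inj₂ (t , e))    (inj₂ (_ , e′)) =
    ↣⇒≤ (count-↣ {ρ} {ρ′} (proj₂ (f t)) e e′)

  -- Position `j` lies outside the image of the injection of occurrences. If `ρ` misses `target`,
  -- its payoff is 0 and `j` alone makes that of `ρ′` positive.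
  ≰ₚ-intro : ∀ ρ ρ′ → Occurrence target ρ′ → (Occurrence target ρ → CountedWithin ρ ρ′) →
             ∀ j → ρ′ .at j ≡ counted → (Occurrence target ρ → ρ .at j ≢ counted) →
             ¬ ρ′ ≤ₚ ρ
  ≰ₚ-intro ρ ρ′ t′ c j p′ ¬p le =
    -- `total` yields payoffs only under double negation, which is enough for deriving `⊥`.
    total ρ λ (m , P) → total ρ′ λ (n , P′) → <⇒≱ (less P P′) (le n m P′ P)
    where
    less : ∀ {m n} → Payoff ρ m → Payoff ρ′ n → m < n
    less _ (inj₁ (¬t′ , _)) = ⊥-elim (¬t′ t′)
    less (inj₁ (_ , refl)) (inj₂ (_ , e′)) =
      >-nonZero⁻¹ _ {{nonZeroIndex (Inverse.from e′ (j , p′))}}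
    less (inj₂ (t , e)) (inj₂ (_ , e′)) =
      ↣-missing⇒< (count-↣ {ρ} {ρ′} (c t) e e′) (Inverse.from e′ (j , p′)) λ k eq →
        let (i , p) = Inverse.to e k
            i≡j = cong proj₁ (Injection.injective (↔⇒↣ (↔-sym e′)) eq)
        in ¬p t (subst (λ i → ρ .at i ≡ counted) i≡j p)

  last-before-target : ∀ ρ → ρ .at 0 ≢ target → ∀ n → ρ .at n ≡ target →
                       ∃ λ m → ρ .at m ≢ target × ρ .at (suc m) ≡ target
  last-before-target ρ ≢₀ zero    t = ⊥-elim (≢₀ t)
  last-before-target ρ ≢₀ (suc n) t with ρ .at n ≟ target
  ... | yes t′ = last-before-target ρ ≢₀ n t′
  ... | no ¬t′ = n , ¬t′ , t

  not-target-before : ∀ ρ n → ρ .at (suc n) ≢ target → ρ .at n ≢ target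
  not-target-before ρ n ≢ eq = ≢ (absorbing (subst (_⟶ _) eq (ρ .step n)))

  module _ {σ σ′ : Strategy₁} {τ τ′ : Strategy₋₁} (Good : ∀ {v} → History v → Set)
    (start : Good [ init ])
    (continue : ∀ v (h : History v) → Good h → proj₁ (next σ τ v h) ≢ target →
                Good (h ▷ proj₂ (next σ τ v h)) × next σ′ τ′ v h ≡ next σ τ v h)
    where

    -- The invariant `Good` is carried along because the two profiles are only known to choose alike
    -- on good histories. As `target` is absorbing, avoiding it at time `suc n` means avoiding it at
    -- time `n`.
    agree-before-target : ∀ n → Out σ τ .at n ≢ target →
                          Good (proj₂ (play σ τ n)) × play σ′ τ′ n ≡ play σ τ n
    agree-before-target zero    _ = start , refl
    agree-before-target (suc n) ≢
      with good , eq ← agree-before-target n (not-target-before (Out σ τ) n ≢)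
      with good′ , eq′ ← continue _ (proj₂ (play σ τ n)) good ≢
      rewrite eq = good′ , cong (λ (w , e) → w , proj₂ (play σ τ n) ▷ e) eq′

-- The game with an opponent

module NoAdmissible𝒢 where

  open G
  open Game 𝒢 hiding (arena)

  s₃≢a : s₃ ≢ a
  s₃≢a ()

  s₃-absorbing : ∀ {w} → Edge s₃ w → w ≡ s₃
  s₃-absorbing s₃s₃ = refl

  open CountIfReached arena _≟_ s₃ a s₃≢a s₃-absorbing using (Occurrence)
  open Comparison arena _≟_ s₃ a s₃≢a s₃-absorbing

  leaves : Successor s₁ → Bool
  leaves (_ , s₁s₃) = true
  leaves (_ , s₁s₂) = false

  -- Whether σ would have left at the last visit to s₁ before the end of the history.
  overdue : Strategy₁ → ∀ {v} → History v → Bool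
  overdue σ [ _ ]            = false
  overdue σ (_▷_ {s₁} h _)   = leaves (σ s₁ h refl)
  overdue σ (_▷_ {s₂} h _)   = overdue σ h
  overdue σ (_▷_ {a}  h _)   = overdue σ h
  overdue σ (_▷_ {s₃} h _)   = overdue σ h

  -- On a history that is not overdue, moving to `s₂` either copies `σ` or starts the extra round.
  delay : Strategy₁ → Strategy₁
  delay σ s₁ h _ = if overdue σ h then (s₃ , s₁s₃) else (s₂ , s₁s₂)
  delay σ a  _ _ = s₁ , as₁
  delay σ s₃ _ _ = s₃ , s₃s₃

  -- Deviates from τ only in the extra round of delay σ: playing σ itself, s₂ is
  -- never reached overdue.
  reward : Strategy₁ → Strategy₋₁ → Strategy₋₁
  reward σ τ zero s₂ h own = if overdue σ h then (a , s₂a) else τ zero s₂ h own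

  leave : Strategy₁
  leave s₁ _ _ = s₃ , s₁s₃
  leave a  _ _ = s₁ , as₁
  leave s₃ _ _ = s₃ , s₃s₃

  always-a : Strategy₋₁
  always-a zero s₂ _ _ = a , s₂a

  module _ (σ : Strategy₁) where

    Fresh : ∀ {v} → History v → Set
    Fresh h = overdue σ h ≡ false

    delay-continue : ∀ τ v (h : History v) → Fresh h → proj₁ (next σ τ v h) ≢ s₃ →
                     Fresh (h ▷ proj₂ (next σ τ v h)) × next (delay σ) τ v h ≡ next σ τ v h
    -- The only move of `σ` avoiding `s₃` goes to `s₂`, as `delay σ` does, and it leaves the history
    -- fresh.
    delay-continue τ s₁ h fresh ≢ rewrite fresh with σ s₁ h refl
    ... | _ , s₁s₂ = refl , refl
    ... | _ , s₁s₃ = ⊥-elim (≢ refl)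
    delay-continue τ s₂ h fresh _ = fresh , refl
    delay-continue τ a  h fresh _ with σ a h refl
    ... | _ , as₁ = fresh , refl
    delay-continue τ s₃ h fresh ≢ with σ s₃ h refl
    ... | _ , s₃s₃ = ⊥-elim (≢ refl)

    reward-continue : ∀ τ v (h : History v) → Fresh h → proj₁ (next σ τ v h) ≢ s₃ →
                      Fresh (h ▷ proj₂ (next σ τ v h)) ×
                      next σ (reward σ τ) v h ≡ next σ τ v h
    reward-continue τ s₁ h fresh ≢ = proj₁ (delay-continue τ s₁ h fresh ≢) , refl
    reward-continue τ s₂ h fresh _ rewrite fresh = refl , refl
    reward-continue τ a  h fresh _ = fresh , refl
    reward-continue τ s₃ h fresh _ = fresh , refl

    delay-agrees : ∀ τ n → Out σ τ .at n ≢ s₃ →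
                   Fresh (proj₂ (play σ τ n)) × play (delay σ) τ n ≡ play σ τ n
    delay-agrees τ = agree-before-target Fresh refl (delay-continue τ)

    reward-agrees : ∀ τ n → Out σ τ .at n ≢ s₃ → play σ (reward σ τ) n ≡ play σ τ n
    reward-agrees τ n ≢ = proj₂ (agree-before-target Fresh refl (reward-continue τ) n ≢)

    -- The history is recorded because the later moves of `delay σ` depend on it through `overdue`.
    LeavesAt : Strategy₋₁ → ℕ → History s₁ → Set
    LeavesAt τ n h = play σ τ n ≡ (s₁ , h) × σ s₁ h refl ≡ (s₃ , s₁s₃)

    -- Apart from `s₃` itself, only `s₁` has an edge to `s₃`.
    leaving-move : ∀ τ v (h : History v) → v ≢ s₃ → proj₁ (next σ τ v h) ≡ s₃ →
                   ∃ λ h′ → _≡_ {A = ∃ History} (v , h) (s₁ , h′) × σ s₁ h′ refl ≡ (s₃ , s₁s₃)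
    leaving-move τ s₁ h _ eq with σ s₁ h refl in move
    leaving-move τ s₁ h _ eq | _ , s₁s₃ = h , refl , move
    leaving-move τ s₂ h _ eq with τ zero s₂ h refl
    leaving-move τ s₂ h _ () | _ , s₂a
    leaving-move τ s₂ h _ () | _ , s₂s₁
    leaving-move τ a  h _ eq with σ a h refl
    leaving-move τ a  h _ () | _ , as₁
    leaving-move τ s₃ h ≢ _ = ⊥-elim (≢ refl)

    leaves-at : ∀ τ → Occurrence s₃ (Out σ τ) → ∃ λ n → ∃ (LeavesAt τ n)
    leaves-at τ (k , t) with n , ≢ , eq ← last-before-target (Out σ τ) (λ ()) k t =
      n , leaving-move τ _ _ ≢ eq

    delay-at-leave : ∀ τ {n h} → LeavesAt τ n h → Fresh h × play (delay σ) τ n ≡ (s₁ , h)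
    delay-at-leave τ {n} (at-h , _)
      with fresh , eq ← delay-agrees τ n (subst (λ x → proj₁ x ≢ s₃) (sym at-h) λ ())
      rewrite at-h = fresh , eq

    -- The extra round takes two moves if the reply is `s₁` and three if it is `a`. The history is
    -- then overdue, so one more move enters `s₃`.
    delay-reaches : ∀ τ {n h} → LeavesAt τ n h → Occurrence s₃ (Out (delay σ) τ)
    delay-reaches τ {n} {h} l@(_ , move)
      with fresh , at-h ← delay-at-leave τ l
      with τ zero s₂ (h ▷ s₁s₂) refl in reply
    ... | _ , s₂s₁ = 3 + n , eq
      where
      eq : Out (delay σ) τ .at (3 + n) ≡ s₃
      eq rewrite at-h | fresh | reply | move = refl
    ... | _ , s₂a = 4 + n , eq
      where
      eq : Out (delay σ) τ .at (4 + n) ≡ s₃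
      eq rewrite at-h | fresh | reply | move = refl

    -- When `σ` visits `a` it is not at `s₃`, so the two plays still coincide.
    delay-counts : ∀ τ → CountedWithin (Out σ τ) (Out (delay σ) τ)
    delay-counts τ i p =
      trans (cong proj₁ (proj₂ (delay-agrees τ i (subst (_≢ s₃) (sym p) λ ())))) p

    delay-dominates : VeryWeaklyDominates (delay σ) σ
    delay-dominates τ = ≤ₚ-intro (Out σ τ) (Out (delay σ) τ) λ t →
      delay-reaches τ (proj₂ (proj₂ (leaves-at τ t))) , delay-counts τ

    reward-leaves : ∀ τ {n h} → LeavesAt τ n h → LeavesAt (reward σ τ) n h
    reward-leaves τ {n} (at-h , move) =
      trans (reward-agrees τ n (subst (λ x → proj₁ x ≢ s₃) (sym at-h) λ ())) at-h , move

    -- Against `τ` itself the extra round may skip `a` and give a tie. `reward σ τ` forces the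
    -- visit, while `σ` still leaves at the same history.
    delay-not-dominated : ∀ τ → Occurrence s₃ (Out σ τ) → ¬ VeryWeaklyDominates σ (delay σ)
    delay-not-dominated τ t dom
      with n , h , l ← leaves-at τ t
      with l′@(at-h , move) ← reward-leaves τ l
      with fresh , at-h′ ← delay-at-leave (reward σ τ) l′ =
      ≰ₚ-intro (Out σ τ′) (Out (delay σ) τ′) (delay-reaches τ′ l′) (λ _ → delay-counts τ′)
        -- From time `n` on, `delay σ` passes through `s₁`, `s₂`, `a`, but `σ` through `s₁`, `s₃`,
        -- `s₃`.
        (2 + n) gains (λ _ → misses) (dom τ′)
      where
      τ′ : Strategy₋₁
      τ′ = reward σ τ
      gains : Out (delay σ) τ′ .at (2 + n) ≡ a
      gains rewrite at-h′ | fresh | move = refl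
      misses : Out σ τ′ .at (2 + n) ≢ a
      misses rewrite at-h | move with σ s₃ (h ▷ s₁s₃) refl
      ... | _ , s₃s₃ = λ ()

  no-admissible : ¬ ∃ Admissible
  no-admissible (σ , admissible) = ¬¬-excluded-middle {A = ∃ λ τ → Occurrence s₃ (Out σ τ)} λ where
    (yes (τ , t)) → admissible (delay σ , delay-dominates σ , delay-not-dominated σ τ t)
    (no never) → admissible (delay leave
      , (λ τ → ≤ₚ-intro (Out σ τ) (Out (delay leave) τ) λ t → ⊥-elim (never (τ , t)))
      -- Against `always-a`, `delay leave` visits `s₁`, `s₂`, `a`, `s₁`, `s₃`: hence the times 4 for
      -- `s₃` and 2 for `a`.
      , λ dom → ≰ₚ-intro (Out σ always-a) (Out (delay leave) always-a) (4 , refl)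
          (λ t → ⊥-elim (never (always-a , t))) 2 refl (λ t → ⊥-elim (never (always-a , t)))
          (dom always-a))

-- The one-player game

module NoAdmissible𝒜 where

  open A
  open Game 𝒜 hiding (arena)

  s₃≢a : s₃ ≢ a
  s₃≢a ()

  s₃-absorbing : ∀ {w} → Edge s₃ w → w ≡ s₃
  s₃-absorbing s₃s₃ = refl

  open CountIfReached arena _≟_ s₃ a s₃≢a s₃-absorbing using (Occurrence)
  open Comparison arena _≟_ s₃ a s₃≢a s₃-absorbing

  leaves : Successor s₁ → Bool
  leaves (_ , s₁s₃) = true
  leaves (_ , s₁a)  = false

  overdue : Strategy₁ → ∀ {v} → History v → Bool
  overdue σ [ _ ]            = false
  overdue σ (_▷_ {s₁} h _)   = leaves (σ s₁ h refl)
  overdue σ (_▷_ {a}  h _)   = overdue σ h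
  overdue σ (_▷_ {s₃} h _)   = overdue σ h

  delay : Strategy₁ → Strategy₁
  delay σ s₁ h _ = if overdue σ h then (s₃ , s₁s₃) else (a , s₁a)
  delay σ a  _ _ = s₁ , as₁
  delay σ s₃ _ _ = s₃ , s₃s₃

  leave : Strategy₁
  leave s₁ _ _ = s₃ , s₁s₃
  leave a  _ _ = s₁ , as₁
  leave s₃ _ _ = s₃ , s₃s₃

  module _ (σ : Strategy₁) (τ : Strategy₋₁) where

    Fresh : ∀ {v} → History v → Set
    Fresh h = overdue σ h ≡ false

    delay-continue : ∀ v (h : History v) → Fresh h → proj₁ (next σ τ v h) ≢ s₃ →
                     Fresh (h ▷ proj₂ (next σ τ v h)) × next (delay σ) τ v h ≡ next σ τ v h
    delay-continue s₁ h fresh ≢ rewrite fresh with σ s₁ h refl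
    ... | _ , s₁a  = refl , refl
    ... | _ , s₁s₃ = ⊥-elim (≢ refl)
    delay-continue a  h fresh _ with σ a h refl
    ... | _ , as₁ = fresh , refl
    delay-continue s₃ h fresh ≢ with σ s₃ h refl
    ... | _ , s₃s₃ = ⊥-elim (≢ refl)

    delay-agrees : ∀ n → Out σ τ .at n ≢ s₃ →
                   Fresh (proj₂ (play σ τ n)) × play (delay σ) τ n ≡ play σ τ n
    delay-agrees = agree-before-target Fresh refl delay-continue

    LeavesAt : ℕ → History s₁ → Set
    LeavesAt n h = play σ τ n ≡ (s₁ , h) × σ s₁ h refl ≡ (s₃ , s₁s₃)

    leaving-move : ∀ v (h : History v) → v ≢ s₃ → proj₁ (next σ τ v h) ≡ s₃ →
                   ∃ λ h′ → _≡_ {A = ∃ History} (v , h) (s₁ , h′) × σ s₁ h′ refl ≡ (s₃ , s₁s₃)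
    leaving-move s₁ h _ eq with σ s₁ h refl in move
    leaving-move s₁ h _ eq | _ , s₁s₃ = h , refl , move
    leaving-move a  h _ eq with σ a h refl
    leaving-move a  h _ () | _ , as₁
    leaving-move s₃ h ≢ _ = ⊥-elim (≢ refl)

    leaves-at : Occurrence s₃ (Out σ τ) → ∃ λ n → ∃ (LeavesAt n)
    leaves-at (k , t) with n , ≢ , eq ← last-before-target (Out σ τ) (λ ()) k t =
      n , leaving-move _ _ ≢ eq

    delay-at-leave : ∀ {n h} → LeavesAt n h → Fresh h × play (delay σ) τ n ≡ (s₁ , h)
    delay-at-leave {n} (at-h , _)
      with fresh , eq ← delay-agrees n (subst (λ x → proj₁ x ≢ s₃) (sym at-h) λ ())
      rewrite at-h = fresh , eq

    -- From time `n` on, `delay σ` visits `s₁`, `a`, `s₁`, `s₃`.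
    delay-reaches : ∀ {n h} → LeavesAt n h → Occurrence s₃ (Out (delay σ) τ)
    delay-reaches {n} l@(_ , move) with fresh , at-h ← delay-at-leave l = 3 + n , eq
      where
      eq : Out (delay σ) τ .at (3 + n) ≡ s₃
      eq rewrite at-h | fresh | move = refl

    delay-counts : CountedWithin (Out σ τ) (Out (delay σ) τ)
    delay-counts i p =
      trans (cong proj₁ (proj₂ (delay-agrees i (subst (_≢ s₃) (sym p) λ ())))) p

    delay-≥ₚ : Out σ τ ≤ₚ Out (delay σ) τ
    delay-≥ₚ = ≤ₚ-intro (Out σ τ) (Out (delay σ) τ) λ t →
      delay-reaches (proj₂ (proj₂ (leaves-at t))) , delay-counts

    -- The extra round always passes through `a`, so `τ` itself witnesses strictness.
    delay-≰ₚ : Occurrence s₃ (Out σ τ) → ¬ Out (delay σ) τ ≤ₚ Out σ τ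
    delay-≰ₚ t
      with n , h , l@(at-h , move) ← leaves-at t
      with fresh , at-h′ ← delay-at-leave l =
      ≰ₚ-intro (Out σ τ) (Out (delay σ) τ) (delay-reaches l) (λ _ → delay-counts)
        -- At this time `delay σ` is at `a` and `σ` already at `s₃`.
        (1 + n) gains (λ _ → misses)
      where
      gains : Out (delay σ) τ .at (1 + n) ≡ a
      gains rewrite at-h′ | fresh = refl
      misses : Out σ τ .at (1 + n) ≢ a
      misses rewrite at-h | move = λ ()

  no-admissible : ¬ ∃ Admissible
  no-admissible (σ , admissible) = ¬¬-excluded-middle {A = ∃ λ τ → Occurrence s₃ (Out σ τ)} λ where
    (yes (τ , t)) → admissible (delay σ , delay-≥ₚ σ , λ dom → delay-≰ₚ σ τ t (dom τ))
    (no never) → admissible (delay leave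
      , (λ τ → ≤ₚ-intro (Out σ τ) (Out (delay leave) τ) λ t → ⊥-elim (never (τ , t)))
      -- `λ ()` is the empty tuple of opposing strategies. The play of `delay leave` is `s₁`, `a`,
      -- `s₁`, `s₃`, with `s₃` at time 3 and `a` at time 1.
      , λ dom → ≰ₚ-intro (Out σ λ ()) (Out (delay leave) λ ()) (3 , refl)
          (λ t → ⊥-elim (never (_ , t))) 1 refl (λ t → ⊥-elim (never (_ , t)))
          (dom λ ()))

lemma3 : (¬ ∃ (Game.Admissible 𝒢)) × (¬ ∃ (Game.Admissible 𝒜))
lemma3 = NoAdmissible𝒢.no-admissible , NoAdmissible𝒜.no-admissible
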